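{- For an integer $n\geq 1$ define $A_n=\{k^2 : k=1,2,\ldots,n\}$, and let $a_n$ denote the median absolute deviation of $A_n$, i.e., \[a_n=\operatorname{median}\left(\{|x-\operatorname{median}(A_n)| : x\in A_n\}\right).\] Then $\lim_{n\to\infty} a_n/n^2=\sqrt{3}/8$.
   Context: The median of a finite collection of real numbers is the middle element when the collection is sorted in increasing order if the number of elements is odd, and the arithmetic mean of the two middle elements if the number of elements is even. -}

module Defs where

open import Data.Empty using (⊥)
open import Data.Integer.Base using (+_)
open import Data.List.Base using (List; []; _∷_; length; map; applyUpTo)
open import Data.Nat.Base as ℕ using (ℕ; zero; suc; parity; ⌊_/2⌋)
open import Data.Nat.Properties using (m^n≢0)
open import Data.Parity.Base using (0ℙ; 1ℙ)
open import Data.Product using (∃-syntax; _×_; _,_)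
open import Data.Rational.Base
  using (ℚ; 0ℚ; 1ℚ; ½; _/_; _+_; _-_; _*_; -_; _<_; _≤_; 1/_; ∣_∣; Positive;
         NonNegative; positive; nonNegative)
open import Data.Rational.Properties
open import Data.Rational.Solver using (module +-*-Solver)
open import Data.Sum.Base using (_⊎_; inj₁; inj₂)
import Data.Sum.Base as Sum
open import Relation.Binary.Definitions using (tri<; tri≈; tri>)
open import Relation.Binary.PropositionalEquality
  using (_≡_; refl; sym; trans; cong; subst; subst₂)
open import Relation.Nullary using (yes; no)
import Data.List.Sort as Sort

open Sort ≤-decTotalOrder using (sort)
open +-*-Solver using (solve; _:=_; _:+_; _:*_; _:-_)

------------------------------------------------------------------------
-- Dedekind reals

record ℝ : Set₁ where
  field
    L U         : ℚ → Set
    L-inhabited : ∃[ q ] L q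
    U-inhabited : ∃[ q ] U q
    L-closed    : ∀ {p q} → p < q → L q → L p
    U-closed    : ∀ {p q} → p < q → U p → U q
    L-open      : ∀ {p} → L p → ∃[ q ] (p < q × L q)
    U-open      : ∀ {q} → U q → ∃[ p ] (p < q × U p)
    disjoint    : ∀ {q} → L q → U q → ⊥
    located     : ∀ {p q} → p < q → L p ⊎ U q

open ℝ

infix 4 _<ℝ_
_<ℝ_ : ℝ → ℝ → Set
x <ℝ y = ∃[ q ] (U x q × L y q)

private
  p-1<p : ∀ p → p - 1ℚ < p
  p-1<p p = subst (p - 1ℚ <_) (+-identityʳ p) (+-monoʳ-< p (negative⁻¹ (- 1ℚ)))

  p<p+1 : ∀ p → p < p + 1ℚ
  p<p+1 p = subst (_< p + 1ℚ) (+-identityʳ p) (+-monoʳ-< p (positive⁻¹ 1ℚ))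

fromℚ : ℚ → ℝ
fromℚ r .L q = q < r
fromℚ r .U q = r < q
fromℚ r .L-inhabited = r - 1ℚ , p-1<p r
fromℚ r .U-inhabited = r + 1ℚ , p<p+1 r
fromℚ r .L-closed = <-trans
fromℚ r .U-closed p<q r<p = <-trans r<p p<q
fromℚ r .L-open p<r = <-dense p<r
fromℚ r .U-open r<q with <-dense r<q
... | m , r<m , m<q = m , m<q , r<m
fromℚ r .disjoint = <-asym
fromℚ r .located {p} {q} p<q with p <? r
... | yes p<r = inj₁ p<r
... | no  p≮r = inj₂ (≤-<-trans (≮⇒≥ p≮r) p<q)

private
  r-[r-q]≡q : ∀ r q → r - (r - q) ≡ q
  r-[r-q]≡q = solve 2 (λ r q → r :- (r :- q) := q) refl

  r-‿antimono : ∀ r {p q} → p < q → r - q < r - p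
  r-‿antimono r p<q = +-monoʳ-< r (neg-antimono-< p<q)

  <-flipˡ : ∀ r {p q} → r - p < q → r - q < p
  <-flipˡ r {p} {q} h = subst (r - q <_) (r-[r-q]≡q r p) (r-‿antimono r h)

  <-flipʳ : ∀ r {p q} → p < r - q → q < r - p
  <-flipʳ r {p} {q} h = subst (_< r - p) (r-[r-q]≡q r q) (r-‿antimono r h)

-- The difference r - x of a rational and a real:  q < r - x  iff  x < r - q.
infixl 6 _⊖_
_⊖_ : ℚ → ℝ → ℝ
(r ⊖ x) .L q = U x (r - q)
(r ⊖ x) .U q = L x (r - q)
(r ⊖ x) .L-inhabited with U-inhabited x
... | u , Uu = r - u , subst (U x) (sym (r-[r-q]≡q r u)) Uu
(r ⊖ x) .U-inhabited with L-inhabited x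
... | l , Ll = r - l , subst (L x) (sym (r-[r-q]≡q r l)) Ll
(r ⊖ x) .L-closed p<q = U-closed x (r-‿antimono r p<q)
(r ⊖ x) .U-closed p<q = L-closed x (r-‿antimono r p<q)
(r ⊖ x) .L-open {p} h with U-open x h
... | u , u<r-p , Uu =
  r - u , <-flipʳ r u<r-p , subst (U x) (sym (r-[r-q]≡q r u)) Uu
(r ⊖ x) .U-open {q} h with L-open x h
... | l , r-q<l , Ll =
  r - l , <-flipˡ r r-q<l , subst (L x) (sym (r-[r-q]≡q r l)) Ll
(r ⊖ x) .disjoint Uq Lq = disjoint x Lq Uq
(r ⊖ x) .located p<q = Sum.swap (located x (r-‿antimono r p<q))

infix 8 -ℝ_
-ℝ_ : ℝ → ℝ
-ℝ x = 0ℚ ⊖ x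

infixl 6 _⊔ℝ_
_⊔ℝ_ : ℝ → ℝ → ℝ
(x ⊔ℝ y) .L q = L x q ⊎ L y q
(x ⊔ℝ y) .U q = U x q × U y q
(x ⊔ℝ y) .L-inhabited with L-inhabited x
... | l , Ll = l , inj₁ Ll
(x ⊔ℝ y) .U-inhabited with U-inhabited x | U-inhabited y
... | u , Uu | v , Uv with <-cmp u v
...   | tri< u<v _ _  = v , U-closed x u<v Uu , Uv
...   | tri≈ _ refl _ = u , Uu , Uv
...   | tri> _ _ v<u  = u , Uu , U-closed y v<u Uv
(x ⊔ℝ y) .L-closed p<q = Sum.map (L-closed x p<q) (L-closed y p<q)
(x ⊔ℝ y) .U-closed p<q (Ux , Uy) = U-closed x p<q Ux , U-closed y p<q Uy
(x ⊔ℝ y) .L-open (inj₁ Lp) with L-open x Lp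
... | q , p<q , Lq = q , p<q , inj₁ Lq
(x ⊔ℝ y) .L-open (inj₂ Lp) with L-open y Lp
... | q , p<q , Lq = q , p<q , inj₂ Lq
(x ⊔ℝ y) .U-open (Ux , Uy) with U-open x Ux | U-open y Uy
... | u , u<q , Uu | v , v<q , Uv with <-cmp u v
...   | tri< u<v _ _  = v , v<q , U-closed x u<v Uu , Uv
...   | tri≈ _ refl _ = u , u<q , Uu , Uv
...   | tri> _ _ v<u  = u , u<q , Uu , U-closed y v<u Uv
(x ⊔ℝ y) .disjoint (inj₁ Lq) (Uq , _) = disjoint x Lq Uq
(x ⊔ℝ y) .disjoint (inj₂ Lq) (_ , Uq) = disjoint y Lq Uq
(x ⊔ℝ y) .located p<q with located x p<q | located y p<q
... | inj₁ Lp | _       = inj₁ (inj₁ Lp)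
... | inj₂ _  | inj₁ Lp = inj₁ (inj₂ Lp)
... | inj₂ Ux | inj₂ Uy = inj₂ (Ux , Uy)

∣_∣ℝ : ℝ → ℝ
∣ x ∣ℝ = x ⊔ℝ (-ℝ x)

private
  module _ (c : ℚ) .{{c>0 : Positive c}} where
    instance
      c≢0 = pos⇒nonZero c
      1/c>0 = 1/pos⇒pos c

    /c*c : ∀ q → q * 1/ c * c ≡ q
    /c*c q = trans (*-assoc q (1/ c) c)
      (trans (cong (q *_) (*-inverseˡ c)) (*-identityʳ q))

    <-/c : ∀ {p q} → p * c < q → p < q * 1/ c
    <-/c {p} {q} h = *-cancelʳ-<-nonNeg c {{pos⇒nonNeg c}}
      (subst (p * c <_) (sym (/c*c q)) h)

    /c-< : ∀ {p q} → p < q * c → p * 1/ c < q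
    /c-< {p} {q} h = *-cancelʳ-<-nonNeg c {{pos⇒nonNeg c}}
      (subst (_< q * c) (sym (/c*c p)) h)

-- The quotient of a real by a positive rational:  q < x / c  iff  q c < x.
infixl 7 _/ℝ_
_/ℝ_ : ℝ → (c : ℚ) .{{_ : Positive c}} → ℝ
(x /ℝ c) .L q = L x (q * c)
(x /ℝ c) .U q = U x (q * c)
(x /ℝ c) .L-inhabited with L-inhabited x
... | l , Ll = l * 1/ c , subst (L x) (sym (/c*c c l)) Ll
  where instance _ = pos⇒nonZero c
(x /ℝ c) .U-inhabited with U-inhabited x
... | u , Uu = u * 1/ c , subst (U x) (sym (/c*c c u)) Uu
  where instance _ = pos⇒nonZero c
(x /ℝ c) .L-closed p<q = L-closed x (*-monoˡ-<-pos c p<q)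
(x /ℝ c) .U-closed p<q = U-closed x (*-monoˡ-<-pos c p<q)
(x /ℝ c) .L-open h with L-open x h
... | l , pc<l , Ll = l * 1/ c , <-/c c pc<l , subst (L x) (sym (/c*c c l)) Ll
  where instance _ = pos⇒nonZero c
(x /ℝ c) .U-open h with U-open x h
... | u , u<qc , Uu = u * 1/ c , /c-< c u<qc , subst (U x) (sym (/c*c c u)) Uu
  where instance _ = pos⇒nonZero c
(x /ℝ c) .disjoint = disjoint x
(x /ℝ c) .located p<q = located x (*-monoˡ-<-pos c p<q)

private
  sq-mono-≤-< : ∀ {p q} → 0ℚ ≤ p → p < q → p * p < q * q
  sq-mono-≤-< {p} {q} 0≤p p<q = ≤-<-trans
    (*-monoˡ-≤-nonNeg p {{nonNegative 0≤p}} {p} {q} (<⇒≤ p<q))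
    (*-monoˡ-<-pos q {{positive (≤-<-trans 0≤p p<q)}} {p} {q} p<q)

  0<q-p : ∀ {p q} → p < q → 0ℚ < q - p
  0<q-p {p} {q} p<q = subst (_< q - p) (+-inverseʳ p) (+-monoˡ-< (- p) p<q)

  -- For 0 ≤ p and p² < r put d = r - p² and δ = d / (2p + 1 + d); then
  -- (p + δ)² < r.
  sqrt-L-open : ∀ {p r} → 0ℚ ≤ p → p * p < r → ∃[ q ] (p < q × q * q < r)
  sqrt-L-open {p} {r} 0≤p p²<r = p + δ , p<p+δ , [p+δ]²<r
    where
    d e D δ : ℚ
    d = r - p * p
    e = p + p + 1ℚ
    D = e + d

    0<d : 0ℚ < d
    0<d = 0<q-p p²<r

    0<e : 0ℚ < e
    0<e = +-mono-≤-< (+-mono-≤ 0≤p 0≤p) (positive⁻¹ 1ℚ)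

    1≤e : 1ℚ ≤ e
    1≤e = subst (_≤ e) (+-identityˡ 1ℚ) (+-monoˡ-≤ 1ℚ (+-mono-≤ 0≤p 0≤p))

    0<D : 0ℚ < D
    0<D = +-mono-< 0<e 0<d

    instance
      D>0 : Positive D
      D>0 = positive 0<D

      D≢0 = pos⇒nonZero D

    δ = d * 1/ D

    0<δ : 0ℚ < δ
    0<δ = <-/c D (subst (_< d) (sym (*-zeroˡ D)) 0<d)

    δD≡d : δ * D ≡ d
    δD≡d = /c*c D d

    δ<1 : δ < 1ℚ
    δ<1 = /c-< D (subst₂ _<_ (+-identityˡ d) (sym (*-identityˡ D))
                   (+-monoˡ-< d 0<e))

    p<p+δ : p < p + δ
    p<p+δ = subst (_< p + δ) (+-identityʳ p) (+-monoʳ-< p 0<δ)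

    δ[2p+δ]<d : δ * (p + p + δ) < d
    δ[2p+δ]<d = subst (δ * (p + p + δ) <_) δD≡d
      (*-monoʳ-<-pos δ {{positive 0<δ}}
        (<-trans (+-monoʳ-< (p + p) δ<1)
          (subst (_< D) (+-identityʳ e) (+-monoʳ-< e 0<d))))

    [p+δ]²<r : (p + δ) * (p + δ) < r
    [p+δ]²<r = subst₂ _<_
      (solve 2 (λ p δ → p :* p :+ δ :* (p :+ p :+ δ) := (p :+ δ) :* (p :+ δ))
        refl p δ)
      (solve 2 (λ p r → p :* p :+ (r :- p :* p) := r) refl p r)
      (+-monoʳ-< (p * p) δ[2p+δ]<d)

  -- For 0 < q and r < q² take the Newton iterate q - η, η = (q² - r) / 2q.
  sqrt-U-open : ∀ {q r} → 0ℚ ≤ r → 0ℚ < q → r < q * q →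
                ∃[ p ] (p < q × 0ℚ < p × r < p * p)
  sqrt-U-open {q} {r} 0≤r 0<q r<q² = q - η , q-η<q , 0<q-η , r<[q-η]²
    where
    d Q η : ℚ
    d = q * q - r
    Q = q + q

    0<Q : 0ℚ < Q
    0<Q = +-mono-< 0<q 0<q

    instance
      Q>0 : Positive Q
      Q>0 = positive 0<Q

      Q≢0 = pos⇒nonZero Q

    η = d * 1/ Q

    ηQ≡d : η * Q ≡ d
    ηQ≡d = /c*c Q d

    0<η : 0ℚ < η
    0<η = <-/c Q (subst (_< d) (sym (*-zeroˡ Q)) (0<q-p r<q²))

    q-η<q : q - η < q
    q-η<q = subst (q - η <_) (+-identityʳ q) (+-monoʳ-< q (neg-antimono-< 0<η))

    d<qQ : d < q * Q
    d<qQ = ≤-<-trans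
      (subst (d ≤_) (+-identityʳ (q * q))
        (+-monoʳ-≤ (q * q) (neg-antimono-≤ 0≤r)))
      (*-monoʳ-<-pos q {{positive 0<q}}
        (subst (_< Q) (+-identityʳ q) (+-monoʳ-< q 0<q)))

    0<q-η : 0ℚ < q - η
    0<q-η = 0<q-p (/c-< Q {q = q} d<qQ)

    r<[q-η]² : r < (q - η) * (q - η)
    r<[q-η]² = subst₂ _<_ (+-identityʳ r) r+η²≡
      (+-monoʳ-< r (positive⁻¹ (η * η)
        {{pos*pos⇒pos η {{positive 0<η}} η {{positive 0<η}}}}))
      where
      r+η²≡ : r + η * η ≡ (q - η) * (q - η)
      r+η²≡ = trans
        (solve 3 (λ q r η → r :+ η :* η
            := (q :* q :- (q :* q :- r)) :+ η :* η) refl q r η)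
        (trans (cong (λ t → (q * q - t) + η * η) (sym ηQ≡d))
          (solve 2 (λ q η → (q :* q :- η :* (q :+ q)) :+ η :* η
            := (q :- η) :* (q :- η)) refl q η))

sqrt : (r : ℚ) .{{_ : NonNegative r}} → ℝ
sqrt r .L q = q < 0ℚ ⊎ q * q < r
sqrt r .U q = 0ℚ < q × r < q * q
sqrt r .L-inhabited = - 1ℚ , inj₁ (negative⁻¹ (- 1ℚ))
sqrt r .U-inhabited = r + 1ℚ , 0<r+1 , r<[r+1]²
  where
  0≤r = nonNegative⁻¹ r

  0<r+1 : 0ℚ < r + 1ℚ
  0<r+1 = +-mono-≤-< 0≤r (positive⁻¹ 1ℚ)

  r<[r+1]² : r < (r + 1ℚ) * (r + 1ℚ)
  r<[r+1]² = <-≤-trans (p<p+1 r)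
    (subst (_≤ (r + 1ℚ) * (r + 1ℚ)) (*-identityˡ (r + 1ℚ))
      (*-monoʳ-≤-nonNeg (r + 1ℚ) {{pos⇒nonNeg (r + 1ℚ) {{positive 0<r+1}}}}
        (subst (_≤ r + 1ℚ) (+-identityˡ 1ℚ) (+-monoˡ-≤ 1ℚ 0≤r))))
sqrt r .L-closed p<q (inj₁ q<0) = inj₁ (<-trans p<q q<0)
sqrt r .L-closed {p} p<q (inj₂ q²<r) with p <? 0ℚ
... | yes p<0 = inj₁ p<0
... | no  p≮0 = inj₂ (<-trans (sq-mono-≤-< (≮⇒≥ p≮0) p<q) q²<r)
sqrt r .U-closed p<q (0<p , r<p²) =
  <-trans 0<p p<q , <-trans r<p² (sq-mono-≤-< (<⇒≤ 0<p) p<q)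
sqrt r .L-open (inj₁ p<0) =
  let m , p<m , m<0 = <-dense p<0 in m , p<m , inj₁ m<0
sqrt r .L-open {p} (inj₂ p²<r) with p <? 0ℚ
... | yes p<0 = let m , p<m , m<0 = <-dense p<0 in m , p<m , inj₁ m<0
... | no  p≮0 =
  let q , p<q , q²<r = sqrt-L-open (≮⇒≥ p≮0) p²<r in q , p<q , inj₂ q²<r
sqrt r .U-open (0<q , r<q²) = sqrt-U-open (nonNegative⁻¹ r) 0<q r<q²
sqrt r .disjoint (inj₁ q<0) (0<q , _) = <-asym q<0 0<q
sqrt r .disjoint (inj₂ q²<r) (_ , r<q²) = <-asym q²<r r<q²
sqrt r .located {p} p<q with p <? 0ℚ | p * p <? r
... | yes p<0 | _        = inj₁ (inj₁ p<0)
... | no  _   | yes p²<r = inj₁ (inj₂ p²<r)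
... | no  p≮0 | no  p²≮r =
  inj₂ (≤-<-trans (≮⇒≥ p≮0) p<q ,
        ≤-<-trans (≮⇒≥ p²≮r) (sq-mono-≤-< (≮⇒≥ p≮0) p<q))

------------------------------------------------------------------------
-- Limits of rational sequences x₁, x₂, …

_⟶_ : ((n : ℕ) .{{_ : ℕ.NonZero n}} → ℚ) → ℝ → Set₁
x ⟶ ℓ = ∀ (ε : ℝ) → fromℚ 0ℚ <ℝ ε →
  ∃[ N ] (∀ n .{{_ : ℕ.NonZero n}} → N ℕ.≤ n → ∣ x n ⊖ ℓ ∣ℝ <ℝ ε)

------------------------------------------------------------------------
-- Medians

-- Zero-based; the value 0 for an index out of range is never used in the
-- median of a nonempty list.
nth : List ℚ → ℕ → ℚ
nth []       _       = 0ℚ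
nth (x ∷ xs) zero    = x
nth (x ∷ xs) (suc i) = nth xs i

-- A finite collection is a list, so repeated values count with multiplicity.
median : List ℚ → ℚ
median xs with parity (length xs)
... | 1ℙ = nth (sort xs) ⌊ length xs /2⌋
... | 0ℙ = ½ * (nth (sort xs) (⌊ length xs /2⌋ ℕ.∸ 1)
              + nth (sort xs) ⌊ length xs /2⌋)

medianAbsoluteDeviation : List ℚ → ℚ
medianAbsoluteDeviation xs = median (map (λ x → ∣ x - median xs ∣) xs)

A : ℕ → List ℚ
A n = applyUpTo (λ i → + (suc i ℕ.^ 2) / 1) n

a : ℕ → ℚ
a n = medianAbsoluteDeviation (A n)

a/n² : (n : ℕ) .{{_ : ℕ.NonZero n}} → ℚ
a/n² n = a n * (+ 1 / (n ℕ.^ 2)) {{m^n≢0 n 2}}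

{-# OPTIONS --safe #-}

-- The median of A n is n²/4 + O(n), and a bound holds for a median as soon as more
-- than half of the entries satisfy it, so everything is a matter of counting.  Let p be
-- the largest integer with p² + (p + n/2)² ≤ n²/2 and put w = n + 4p.  Up to O(n), the
-- n/2 integers k following p have |k² - n²/4| ≤ nw/8, and the others have
-- |k² - n²/4| ≥ nw/8; hence a n = nw/8 + O(n).  The choice of p amounts to
-- w² ≤ 3n² < (w + 4)², so 8 (a n) / n² = w/n + O(1/n) tends to √3.

module Submission where

open import Defs
open import Data.Integer.Base using (+_)
open import Data.Rational.Base using (_/_)
import Data.Integer.Base as ℤ
import Data.Integer.Properties as ℤ
open import Data.List.Base using (List; []; _∷_; _++_; length; map; filter; applyUpTo)
open import Data.List.Properties
  using (length-applyUpTo; length-++; length-filter; map-applyUpTo; filter-++;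
         filter-all; filter-none)
open import Data.List.Relation.Binary.Permutation.Propositional.Properties
  using (↭-length; filter-↭)
open import Data.List.Relation.Unary.All as All using (All; []; _∷_)
open import Data.List.Relation.Unary.All.Properties using (applyUpTo⁺₁)
open import Data.List.Relation.Unary.AllPairs using (AllPairs; []; _∷_)
open import Data.List.Relation.Unary.Linked.Properties using (Linked⇒AllPairs)
open import Data.Nat.Base as ℕ using (ℕ; zero; suc; parity; ⌊_/2⌋; z≤n; s≤s)
import Data.Nat.Properties as ℕ
import Data.Nat.Coprimality as Coprime
import Data.Nat.Solver as ℕ
open import Data.Parity.Base using (0ℙ; 1ℙ)
open import Data.Product using (∃-syntax; _×_; _,_; proj₁; proj₂)
open import Data.Rational.Base
  using (ℚ; mkℚ; 0ℚ; 1ℚ; ½; _+_; _-_; _*_; -_; _<_; _≤_; *≤*; *<*; 1/_; ∣_∣; Positive;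
         NonNegative; positive; nonNegative)
open import Data.Rational.Literals using (fromℤ)
open import Data.Rational.Properties
import Data.Rational.Solver as ℚ
open import Data.Sum.Base using (_⊎_; inj₁; inj₂)
open import Function.Base using (_∘_)
open import Level using (0ℓ)
open import Relation.Binary.PropositionalEquality
  using (_≡_; refl; sym; trans; cong; cong₂; subst; subst₂)
open import Relation.Nullary using (¬_; yes; no; contradiction)
open import Relation.Unary using (Pred; Decidable)
import Data.List.Sort as Sort

open Sort ≤-decTotalOrder using (sort; sort-↭; sort-↗)

-- Inequalities between naturals, and halving

-- A linear combination A ≤ B of hypotheses proves X ≤ Y as soon as
-- X - Y = A - B - r; subtraction is avoided.
linear : ∀ {A B X Y : ℕ} → A ℕ.≤ B → ∀ r → X ℕ.+ B ℕ.+ r ≡ Y ℕ.+ A → X ℕ.≤ Y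
linear {A} {B} {X} {Y} A≤B r eq = ℕ.+-cancelʳ-≤ B X Y (begin
  X ℕ.+ B           ≤⟨ ℕ.m≤m+n (X ℕ.+ B) r ⟩
  X ℕ.+ B ℕ.+ r     ≡⟨ eq ⟩
  Y ℕ.+ A           ≤⟨ ℕ.+-monoʳ-≤ Y A≤B ⟩
  Y ℕ.+ B           ∎)
  where open ℕ.≤-Reasoning

infixl 6 _⊕_
-- With sums and multiples as operators, the first argument of `linear` is written as the linear
-- combination itself.
_⊕_ : ∀ {a b c d : ℕ} → a ℕ.≤ b → c ℕ.≤ d → a ℕ.+ c ℕ.≤ b ℕ.+ d
_⊕_ = ℕ.+-mono-≤

infixl 7 _⊛_
_⊛_ : ∀ {a b : ℕ} k → a ℕ.≤ b → k ℕ.* a ℕ.≤ k ℕ.* b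
k ⊛ a≤b = ℕ.*-monoʳ-≤ k a≤b

⌊n/2⌋-lower : ∀ n → n ℕ.≤ 1 ℕ.+ 2 ℕ.* ⌊ n /2⌋
⌊n/2⌋-lower zero          = z≤n
⌊n/2⌋-lower (suc zero)    = s≤s z≤n
⌊n/2⌋-lower (suc (suc n)) =
  linear (⌊n/2⌋-lower n) 0 (solve 2 (λ n h →
    con 2 :+ n :+ (con 1 :+ con 2 :* h) :+ con 0 := con 1 :+ con 2 :* (con 1 :+ h) :+ n)
    refl n ⌊ n /2⌋)
  where open ℕ.+-*-Solver

⌊n/2⌋-upper : ∀ n → 2 ℕ.* ⌊ n /2⌋ ℕ.≤ n
⌊n/2⌋-upper zero          = z≤n
⌊n/2⌋-upper (suc zero)    = z≤n
⌊n/2⌋-upper (suc (suc n)) =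
  linear (⌊n/2⌋-upper n) 0 (solve 2 (λ n h →
    con 2 :* (con 1 :+ h) :+ n :+ con 0 := con 2 :+ n :+ con 2 :* h)
    refl n ⌊ n /2⌋)
  where open ℕ.+-*-Solver

even⇒2*⌊n/2⌋ : ∀ n → parity n ≡ 0ℙ → n ≡ 2 ℕ.* ⌊ n /2⌋
even⇒2*⌊n/2⌋ zero          _  = refl
even⇒2*⌊n/2⌋ (suc (suc n)) eq =
  trans (cong (suc ∘ suc) (even⇒2*⌊n/2⌋ n eq)) (sym (ℕ.*-suc 2 ⌊ n /2⌋))

-- Medians of lists in which a majority satisfies a monotone predicate

module _ {P : Pred ℚ 0ℓ} (P? : Decidable P) where

  count : List ℚ → ℕ
  count xs = length (filter P? xs)

  -- In a sorted list the entries satisfying a downward closed `P` form an initial segment, whose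
  -- length is the count.
  nth-downward : (∀ {x y} → x ≤ y → P y → P x) →
    ∀ {xs} → AllPairs _≤_ xs → ∀ i → i ℕ.< count xs → P (nth xs i)
  nth-downward down {[]} _ i ()
  nth-downward down {x ∷ xs} (x≤xs ∷ xs↗) i i<c with P? x
  -- If the head fails, so does every later entry; the count is then 0 and no index is below it.
  ... | no ¬Px = contradiction i<c (ℕ.<⇒≱ (s≤s (subst (λ ys → length ys ℕ.≤ i)
          (sym (filter-none P? (All.map (λ x≤y Py → ¬Px (down x≤y Py)) x≤xs))) z≤n)))
  nth-downward down {x ∷ xs} (x≤xs ∷ xs↗) zero    i<c       | yes Px = Px
  nth-downward down {x ∷ xs} (x≤xs ∷ xs↗) (suc i) (s≤s i<c) | yes Px =
    nth-downward down xs↗ i i<c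

  nth-all : ∀ {xs} → All P xs → ∀ i → i ℕ.< length xs → P (nth xs i)
  nth-all (Px ∷ _)  zero    _         = Px
  nth-all (_ ∷ Pxs) (suc i) (s≤s i<n) = nth-all Pxs i i<n

  -- Dually, the failing entries come first. The last hypothesis says, without subtraction, that `i`
  -- lies beyond all of them.
  nth-upward : (∀ {x y} → x ≤ y → P x → P y) →
    ∀ {xs} → AllPairs _≤_ xs → ∀ i → i ℕ.< length xs →
    length xs ℕ.≤ i ℕ.+ count xs → P (nth xs i)
  nth-upward up {x ∷ xs} (x≤xs ∷ xs↗) i i<n n≤i+c with P? x
  ... | yes Px = nth-all (Px ∷ All.map (λ x≤y → up x≤y Px) x≤xs) i i<n
  nth-upward up {x ∷ xs} (x≤xs ∷ xs↗) zero _ n≤i+c | no ¬Px =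
    contradiction n≤i+c (ℕ.<⇒≱ (s≤s (length-filter P? xs)))
  nth-upward up {x ∷ xs} (x≤xs ∷ xs↗) (suc i) (s≤s i<n) (s≤s n≤i+c) | no ¬Px =
    nth-upward up xs↗ i i<n n≤i+c

  -- Whatever the parity of the length `n`, each index `i` that `median` reads satisfies
  -- `2 i ≤ n ≤ 2 i + 2`, and positive length keeps it in range.
  median-elim : (∀ {x y} → P x → P y → P (½ * (x + y))) →
    ∀ xs → 0 ℕ.< length xs →
    (∀ i → i ℕ.< length xs → 2 ℕ.* i ℕ.≤ length xs → length xs ℕ.≤ 2 ℕ.+ 2 ℕ.* i →
      P (nth (sort xs) i)) →
    P (median xs)
  median-elim mid xs 0<n central with parity (length xs) in eq
  ... | 1ℙ = central ⌊ n /2⌋ (h<n 0<n) (⌊n/2⌋-upper n) (ℕ.m≤n⇒m≤1+n (⌊n/2⌋-lower n))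
    where
    n = length xs
    h<n : ∀ {n} → 0 ℕ.< n → ⌊ n /2⌋ ℕ.< n
    h<n {suc n} _ = ℕ.⌊n/2⌋<n n
  ... | 0ℙ with length xs | even⇒2*⌊n/2⌋ (length xs) eq
  -- Here `n` is the length minus 2, so the two middle indices are `h` and `suc h`.
  ...   | suc (suc n) | n≡2h = mid
    (central h (ℕ.m≤n⇒m≤1+n (s≤s (ℕ.⌊n/2⌋≤n n)))
      (ℕ.≤-trans (⌊n/2⌋-upper n) (ℕ.m≤n+m n 2))
      (ℕ.≤-reflexive (trans n≡2h (ℕ.*-suc 2 h))))
    (central (suc h) (s≤s (s≤s (ℕ.⌊n/2⌋≤n n)))
      (ℕ.≤-reflexive (sym n≡2h))
      (ℕ.≤-trans (ℕ.≤-reflexive n≡2h) (ℕ.m≤n+m (2 ℕ.* suc h) 2)))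
    where h = ⌊ n /2⌋

  count-sort : ∀ xs → count (sort xs) ≡ count xs
  count-sort xs = ↭-length (filter-↭ P? (sort-↭ xs))

  0<length : ∀ xs → length xs ℕ.< 2 ℕ.* count xs → 0 ℕ.< length xs
  0<length (_ ∷ _) _ = s≤s z≤n

½-double : ∀ x → ½ * (x + x) ≡ x
½-double x = trans (cong (½ *_) (cong₂ _+_ (sym (*-identityˡ x)) (sym (*-identityˡ x))))
  (trans (cong (½ *_) (sym (*-distribʳ-+ x 1ℚ 1ℚ)))
    (trans (sym (*-assoc ½ (1ℚ + 1ℚ) x)) (*-identityˡ x)))

midpoint≤ : ∀ {x y} → x ≤ y → ½ * (x + y) ≤ y
midpoint≤ {x} {y} x≤y = subst (½ * (x + y) ≤_) (½-double y)
  (*-monoˡ-≤-nonNeg ½ (+-monoˡ-≤ y x≤y))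

≤midpoint : ∀ {x y} → x ≤ y → x ≤ ½ * (x + y)
≤midpoint {x} {y} x≤y = subst (_≤ ½ * (x + y)) (½-double x)
  (*-monoˡ-≤-nonNeg ½ (+-monoʳ-≤ x x≤y))

module _ {P : Pred ℚ 0ℓ} (P? : Decidable P) where

  -- A middle index has `2 i ≤ n < 2 c`, so it falls into the initial segment of length `c`; a mean
  -- of two entries is at most the larger one.
  majority-downward : (∀ {x y} → x ≤ y → P y → P x) →
    ∀ xs → length xs ℕ.< 2 ℕ.* count P? xs → P (median xs)
  majority-downward down xs n<2c = median-elim P? mid xs (0<length P? xs n<2c)
    λ i _ 2i≤n _ → nth-downward P? down (Linked⇒AllPairs ≤-trans (sort-↗ xs)) i
      (subst (i ℕ.<_) (sym (count-sort P? xs))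
        (ℕ.*-cancelˡ-< 2 _ _ (ℕ.≤-<-trans 2i≤n n<2c)))
    where
    mid : ∀ {x y} → P x → P y → P (½ * (x + y))
    mid {x} {y} Px Py with ≤-total x y
    ... | inj₁ x≤y = down (midpoint≤ x≤y) Py
    ... | inj₂ y≤x = down (subst (λ s → ½ * s ≤ x) (+-comm y x) (midpoint≤ y≤x)) Px

  majority-upward : (∀ {x y} → x ≤ y → P x → P y) →
    ∀ xs → length xs ℕ.< 2 ℕ.* count P? xs → P (median xs)
  majority-upward up xs n<2c = median-elim P? mid xs (0<length P? xs n<2c)
    λ i i<n _ n≤2+2i → nth-upward P? up (Linked⇒AllPairs ≤-trans (sort-↗ xs)) i
      (subst (i ℕ.<_) (sym |sort|) i<n)
      (subst₂ (λ l c → l ℕ.≤ i ℕ.+ c) (sym |sort|) (sym (count-sort P? xs))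
        (enough (length xs) i (count P? xs) n≤2+2i n<2c))
    where
    |sort| : length (sort xs) ≡ length xs
    |sort| = ↭-length (sort-↭ xs)

    enough : ∀ n i c → n ℕ.≤ 2 ℕ.+ 2 ℕ.* i → n ℕ.< 2 ℕ.* c → n ℕ.≤ i ℕ.+ c
    -- The sum of the hypotheses is `2 n < 2 (i + c + 1)`; strictness of the majority is what saves
    -- the last unit.
    enough n i c n≤2+2i n<2c = ℕ.s≤s⁻¹ (ℕ.*-cancelˡ-< 2 n (suc (i ℕ.+ c))
      (linear (n≤2+2i ⊕ n<2c) 0 (solve 3 (λ n i c →
        con 1 :+ con 2 :* n :+ (con 2 :+ con 2 :* i :+ con 2 :* c) :+ con 0
        := con 2 :* (con 1 :+ (i :+ c)) :+ (n :+ (con 1 :+ n))) refl n i c)))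
      where open ℕ.+-*-Solver

    mid : ∀ {x y} → P x → P y → P (½ * (x + y))
    mid {x} {y} Px Py with ≤-total x y
    ... | inj₁ x≤y = up (≤midpoint x≤y) Px
    ... | inj₂ y≤x = up (subst (λ s → y ≤ ½ * s) (+-comm y x) (≤midpoint y≤x)) Py

-- Counting over blocks of indices

applyUpTo-++ : ∀ (f : ℕ → ℚ) m n →
  applyUpTo f (m ℕ.+ n) ≡ applyUpTo f m ++ applyUpTo (f ∘ (m ℕ.+_)) n
applyUpTo-++ f zero    n = refl
applyUpTo-++ f (suc m) n = cong (f 0 ∷_) (applyUpTo-++ (f ∘ suc) m n)

module _ {P : Pred ℚ 0ℓ} (P? : Decidable P) where

  count-++ : ∀ xs ys → count P? (xs ++ ys) ≡ count P? xs ℕ.+ count P? ys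
  count-++ xs ys = trans (cong length (filter-++ P? xs ys)) (length-++ (filter P? xs))

  count-+ : ∀ f m n → count P? (applyUpTo f (m ℕ.+ n)) ≡
    count P? (applyUpTo f m) ℕ.+ count P? (applyUpTo (f ∘ (m ℕ.+_)) n)
  count-+ f m n = trans (cong (count P?) (applyUpTo-++ f m n)) (count-++ (applyUpTo f m) _)

  count-all : ∀ f n → (∀ i → i ℕ.< n → P (f i)) → count P? (applyUpTo f n) ≡ n
  count-all f n all = trans
    (cong length (filter-all P? (applyUpTo⁺₁ f n (λ {i} → all i)))) (length-applyUpTo f n)

  -- Cutting at `p` and `p + m` splits the count into three summands, of which only the middle one
  -- is kept.
  count-window : ∀ f p m {n} → p ℕ.+ m ℕ.≤ n → (∀ i → i ℕ.< m → P (f (p ℕ.+ i))) →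
    m ℕ.≤ count P? (applyUpTo f n)
  count-window f p m p+m≤n inside with ℕ.m≤n⇒∃[o]m+o≡n p+m≤n
  ... | r , refl = begin
    m                                     ≡⟨ count-all (f ∘ (p ℕ.+_)) m inside ⟨
    count P? (applyUpTo (f ∘ (p ℕ.+_)) m) ≤⟨ ℕ.m≤n+m _ _ ⟩
    count P? (applyUpTo f p) ℕ.+ count P? (applyUpTo (f ∘ (p ℕ.+_)) m)
                                          ≡⟨ count-+ f p m ⟨
    count P? (applyUpTo f (p ℕ.+ m))      ≤⟨ ℕ.m≤m+n _ _ ⟩
    count P? (applyUpTo f (p ℕ.+ m)) ℕ.+ count P? (applyUpTo (f ∘ (p ℕ.+ m ℕ.+_)) r)
                                          ≡⟨ count-+ f (p ℕ.+ m) r ⟨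
    count P? (applyUpTo f (p ℕ.+ m ℕ.+ r)) ∎
    where open ℕ.≤-Reasoning

  -- With the same cuts, the middle summand is dropped instead.
  count-outside : ∀ f p m r {n} → p ℕ.+ m ℕ.+ r ≡ n → (∀ i → i ℕ.< p → P (f i)) →
    (∀ i → i ℕ.< r → P (f (p ℕ.+ m ℕ.+ i))) →
    p ℕ.+ r ℕ.≤ count P? (applyUpTo f n)
  count-outside f p m r refl below above = begin
    p ℕ.+ r ≡⟨ cong₂ ℕ._+_ (count-all f p below) (count-all (f ∘ (p ℕ.+ m ℕ.+_)) r above) ⟨
    count P? (applyUpTo f p) ℕ.+ count P? (applyUpTo (f ∘ (p ℕ.+ m ℕ.+_)) r)
      ≤⟨ ℕ.+-monoˡ-≤ (count P? (applyUpTo (f ∘ (p ℕ.+ m ℕ.+_)) r))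
           (ℕ.m≤m+n (count P? (applyUpTo f p)) (count P? (applyUpTo (f ∘ (p ℕ.+_)) m))) ⟩
    count P? (applyUpTo f p) ℕ.+ count P? (applyUpTo (f ∘ (p ℕ.+_)) m)
      ℕ.+ count P? (applyUpTo (f ∘ (p ℕ.+ m ℕ.+_)) r)
      ≡⟨ cong (ℕ._+ count P? (applyUpTo (f ∘ (p ℕ.+ m ℕ.+_)) r)) (count-+ f p m) ⟨
    count P? (applyUpTo f (p ℕ.+ m)) ℕ.+ count P? (applyUpTo (f ∘ (p ℕ.+ m ℕ.+_)) r)
      ≡⟨ count-+ f (p ℕ.+ m) r ⟨
    count P? (applyUpTo f (p ℕ.+ m ℕ.+ r)) ∎
    where open ℕ.≤-Reasoning

-- Naturals as rationals

fromℕ : ℕ → ℚ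
fromℕ n = fromℤ (+ n)

-- `_/_` normalises by a gcd, whereas `fromℕ n` is already in lowest terms with denominator 1;
-- coprimality to 1 identifies the two.
/1≡fromℕ : ∀ n → + n / 1 ≡ fromℕ n
/1≡fromℕ n = normalize-coprime (Coprime.sym (Coprime.1-coprimeTo n))

fromℕ-+ : ∀ m n → fromℕ (m ℕ.+ n) ≡ fromℕ m + fromℕ n
fromℕ-+ m n = trans (sym (/1≡fromℕ (m ℕ.+ n)))
  (cong (_/ 1) (sym (cong₂ ℤ._+_ (ℤ.*-identityʳ (+ m)) (ℤ.*-identityʳ (+ n)))))

fromℕ-* : ∀ m n → fromℕ (m ℕ.* n) ≡ fromℕ m * fromℕ n
fromℕ-* m n = trans (sym (/1≡fromℕ (m ℕ.* n))) (cong (_/ 1) (ℤ.pos-* m n))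

fromℕ-mono-≤ : ∀ {m n} → m ℕ.≤ n → fromℕ m ≤ fromℕ n
fromℕ-mono-≤ m≤n = *≤* (ℤ.*-monoʳ-≤-nonNeg (+ 1) (ℤ.+≤+ m≤n))

fromℕ-mono-< : ∀ {m n} → m ℕ.< n → fromℕ m < fromℕ n
fromℕ-mono-< m<n = *<* (ℤ.*-monoʳ-<-pos (+ 1) (ℤ.+<+ m<n))

fromℕ*1/n≡1 : ∀ n .{{_ : ℕ.NonZero n}} → fromℕ n * (+ 1 / n) ≡ 1ℚ
fromℕ*1/n≡1 (suc n) = trans
  (cong (fromℕ (suc n) *_) (normalize-coprime (Coprime.1-coprimeTo (suc n))))
  (*-inverseʳ (fromℕ (suc n)))

-- A positive `q` with denominator `1 + d` has numerator at least 1, so `1 ≤ q (1 + d)`; multiply by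
-- `k`.
archimedean : ∀ {q} → 0ℚ < q → ∀ k → ∃[ d ] (∀ n → k ℕ.* suc d ℕ.≤ n → fromℕ k ≤ q * fromℕ n)
archimedean {q@(mkℚ ℤ.+[1+ m ] d _)} 0<q k = d , λ n k[1+d]≤n → begin
  fromℕ k                       ≡⟨ *-identityʳ (fromℕ k) ⟨
  fromℕ k * 1ℚ                  ≤⟨ *-monoˡ-≤-nonNeg (fromℕ k) 1≤q[1+d] ⟩
  fromℕ k * (q * fromℕ (suc d)) ≡⟨ solve 3 (λ k q d → k :* (q :* d) := q :* (k :* d))
                                     refl (fromℕ k) q (fromℕ (suc d)) ⟩
  q * (fromℕ k * fromℕ (suc d)) ≡⟨ cong (q *_) (fromℕ-* k (suc d)) ⟨
  q * fromℕ (k ℕ.* suc d)       ≤⟨ *-monoˡ-≤-nonNeg q (fromℕ-mono-≤ k[1+d]≤n) ⟩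
  q * fromℕ n                   ∎
  where
  open ≤-Reasoning
  open ℚ.+-*-Solver

  1/q≤1+d : 1/ q ≤ fromℕ (suc d)
  1/q≤1+d = *≤* (ℤ.+≤+ (ℕ.*-monoʳ-≤ (suc d) (s≤s (z≤n {m}))))

  1≤q[1+d] : 1ℚ ≤ q * fromℕ (suc d)
  1≤q[1+d] = subst (_≤ q * fromℕ (suc d)) (*-inverseʳ q) (*-monoˡ-≤-nonNeg q 1/q≤1+d)
archimedean {mkℚ (+ 0) _ _}      0<q = contradiction (positive 0<q) λ ()
archimedean {mkℚ ℤ.-[1+ _ ] _ _} 0<q = contradiction (positive 0<q) λ ()

-- Inequalities between rationals and absolute values

-- The rational counterpart of `linear`, without slack: `eq` says `X - Y = A - B`.
linearℚ : ∀ {A B X Y : ℚ} → A ≤ B → X + B ≡ Y + A → X ≤ Y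
linearℚ {A} {B} {X} {Y} A≤B eq = subst₂ _≤_
  (solve 2 (λ X B → X :+ B :- B := X) refl X B)
  (solve 2 (λ Y B → Y :+ B :- B := Y) refl Y B)
  (+-monoˡ-≤ (- B) (≤-trans (≤-reflexive eq) (+-monoʳ-≤ Y A≤B)))
  where open ℚ.+-*-Solver

p≤∣p∣ : ∀ p → p ≤ ∣ p ∣
p≤∣p∣ p with ≤-total 0ℚ p
... | inj₁ 0≤p = ≤-reflexive (sym (0≤p⇒∣p∣≡p 0≤p))
... | inj₂ p≤0 = ≤-trans p≤0 (0≤∣p∣ p)

-- The hypotheses contain no subtraction, so that inequalities between naturals can be transported
-- to them by `fromℕ`.
s*∣x-m∣≤b : ∀ s x m b → s * x ≤ s * m + b → s * m ≤ s * x + b → s * ∣ x - m ∣ ≤ b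
s*∣x-m∣≤b s x m b above below with ∣p∣≡p∨∣p∣≡-p (x - m)
... | inj₁ eq = subst (λ t → s * t ≤ b) (sym eq) (linearℚ above
  (solve 4 (λ s x m b → s :* (x :- m) :+ (s :* m :+ b)
    := b :+ s :* x) refl s x m b))
  where open ℚ.+-*-Solver
... | inj₂ eq = subst (λ t → s * t ≤ b) (sym eq) (linearℚ below
  (solve 4 (λ s x m b → s :* (:- (x :- m)) :+ (s :* x :+ b)
    := b :+ s :* m) refl s x m b))
  where open ℚ.+-*-Solver

-- The absolute value dominates both `x - m` and its negative, so a bound on either side of `m`
-- suffices.
b≤s*∣x-m∣+c : ∀ s .{{_ : NonNegative s}} x m b c →
  b + s * m ≤ s * x + c ⊎ b + s * x ≤ s * m + c → b ≤ s * ∣ x - m ∣ + c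
b≤s*∣x-m∣+c s x m b c far = ≤-trans (one-side far) (+-monoˡ-≤ c (*-monoˡ-≤-nonNeg s (larger far)))
  where
  side : b + s * m ≤ s * x + c ⊎ b + s * x ≤ s * m + c → ℚ
  side (inj₁ _) = x - m
  side (inj₂ _) = - (x - m)

  one-side : ∀ h → b ≤ s * side h + c
  one-side (inj₁ h) = linearℚ h
    (solve 5 (λ s x m b c → b :+ (s :* x :+ c)
      := s :* (x :- m) :+ c :+ (b :+ s :* m)) refl s x m b c)
    where open ℚ.+-*-Solver
  one-side (inj₂ h) = linearℚ h
    (solve 5 (λ s x m b c → b :+ (s :* m :+ c)
      := s :* (:- (x :- m)) :+ c :+ (b :+ s :* x)) refl s x m b c)
    where open ℚ.+-*-Solver

  larger : ∀ h → side h ≤ ∣ x - m ∣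
  larger (inj₁ _) = p≤∣p∣ (x - m)
  larger (inj₂ _) = subst (- (x - m) ≤_) (∣-p∣≡∣p∣ (x - m)) (p≤∣p∣ (- (x - m)))

sq-mono-< : ∀ {p q} → 0ℚ ≤ p → p < q → p * p < q * q
sq-mono-< {p} {q} 0≤p p<q = ≤-<-trans
  (*-monoˡ-≤-nonNeg p {{nonNegative 0≤p}} (<⇒≤ p<q))
  (*-monoˡ-<-pos q {{positive (≤-<-trans 0≤p p<q)}} p<q)

-- The choice of `p` and its inequalities

-- The largest solution p of p² + (p + n/2)² ≤ n²/2; the inequality is multiplied by 4
-- and n² is cancelled.
record Cut (n : ℕ) : Set where
  constructor cut
  field
    p     : ℕ
    below : 8 ℕ.* (p ℕ.* p) ℕ.+ 4 ℕ.* (p ℕ.* n) ℕ.≤ n ℕ.* n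
    above : n ℕ.* n ℕ.< 8 ℕ.* (suc p ℕ.* suc p) ℕ.+ 4 ℕ.* (suc p ℕ.* n)

-- Descending from the failing bound `b`, the first success met has a failing successor.
last-true : ∀ {P : Pred ℕ 0ℓ} → Decidable P → P 0 → ∀ b → ¬ P b →
  ∃[ k ] P k × ¬ P (suc k)
last-true P? P0 zero    ¬Pb = contradiction P0 ¬Pb
last-true P? P0 (suc b) ¬Pb with P? b
... | yes Pb  = b , Pb , ¬Pb
... | no  ¬Pb = last-true P? P0 b ¬Pb

cut-exists : ∀ n .{{_ : ℕ.NonZero n}} → Cut n
cut-exists n@(suc _) =
  -- `p = 0` solves the inequality, and `p = n` does not because `12 n² > n²`.
  let p , below , ¬above = last-true
        (λ p → 8 ℕ.* (p ℕ.* p) ℕ.+ 4 ℕ.* (p ℕ.* n) ℕ.≤? n ℕ.* n) z≤n n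
        (ℕ.<⇒≱ (ℕ.<-≤-trans (ℕ.m<m*n (n ℕ.* n) 8 (s≤s (s≤s z≤n)))
          (ℕ.≤-trans (ℕ.≤-reflexive (ℕ.*-comm (n ℕ.* n) 8))
            (ℕ.m≤m+n (8 ℕ.* (n ℕ.* n)) (4 ℕ.* (n ℕ.* n))))))
  in cut p below (ℕ.≰⇒> ¬above)

module Arithmetic {n} .{{_ : ℕ.NonZero n}} (c : Cut n) where
  open Cut c public
  open ℕ.+-*-Solver

  1≤n : 1 ℕ.≤ n
  1≤n = ℕ.>-nonZero⁻¹ n

  w : ℕ
  w = n ℕ.+ 4 ℕ.* p

  -- Drop `8 p²` from `below` and cancel `n`. This turns error terms in `p` into O(n) and later
  -- keeps the window inside `1, …, n`.
  4p≤n : 4 ℕ.* p ℕ.≤ n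
  4p≤n = ℕ.*-cancelʳ-≤ (4 ℕ.* p) n n
    (ℕ.≤-trans (ℕ.≤-reflexive (ℕ.*-assoc 4 p n)) (ℕ.≤-trans
      (ℕ.m≤n+m (4 ℕ.* (p ℕ.* n)) (8 ℕ.* (p ℕ.* p))) below))

  -- `w² = n² + 2 (8 p² + 4 p n)`; replacing `p` by `p + 1` turns `w` into `w + 4`, which gives the
  -- companion bound from `above`.
  w²≤3n² : w ℕ.* w ℕ.≤ 3 ℕ.* (n ℕ.* n)
  w²≤3n² = linear (2 ⊛ below) 0 (solve 2 (λ n p →
    (n :+ con 4 :* p) :* (n :+ con 4 :* p) :+ con 2 :* (n :* n) :+ con 0
    := con 3 :* (n :* n) :+ con 2 :* (con 8 :* (p :* p) :+ con 4 :* (p :* n)))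
    refl n p)

  3n²<[w+4]² : 3 ℕ.* (n ℕ.* n) ℕ.< (w ℕ.+ 4) ℕ.* (w ℕ.+ 4)
  3n²<[w+4]² = linear (2 ⊛ above) 1 (solve 2 (λ n p →
    con 1 :+ con 3 :* (n :* n)
      :+ con 2 :* (con 8 :* ((con 1 :+ p) :* (con 1 :+ p)) :+ con 4 :* ((con 1 :+ p) :* n))
      :+ con 1
    := (n :+ con 4 :* p :+ con 4) :* (n :+ con 4 :* p :+ con 4)
      :+ con 2 :* (con 1 :+ n :* n))
    refl n p)

  -- Up to O(n), `8 k²` is at most `2 (2 p + n)² = 2 n² + (8 p² + 4 p n) + 4 p
  -- n`, and `below` bounds this by `2 n² + w n`.
  inner-above : ∀ k → 2 ℕ.* k ℕ.≤ 2 ℕ.* p ℕ.+ n ℕ.+ 2 →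
    8 ℕ.* (k ℕ.* k) ℕ.≤ 2 ℕ.* (n ℕ.* n) ℕ.+ (w ℕ.+ 32) ℕ.* n
  inner-above k 2k≤ = linear
    (2 ⊛ ℕ.*-mono-≤ 2k≤ 2k≤ ⊕ below ⊕ 4 ⊛ 4p≤n ⊕ 8 ⊛ 1≤n) (12 ℕ.* n)
    (solve 3 (λ n p k →
      con 8 :* (k :* k)
        :+ (con 2 :* ((con 2 :* p :+ n :+ con 2) :* (con 2 :* p :+ n :+ con 2))
          :+ n :* n :+ con 4 :* n :+ con 8 :* n)
        :+ con 12 :* n
      := con 2 :* (n :* n) :+ (n :+ con 4 :* p :+ con 32) :* n
        :+ (con 2 :* (con 2 :* k :* (con 2 :* k))
          :+ (con 8 :* (p :* p) :+ con 4 :* (p :* n))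
          :+ con 4 :* (con 4 :* p) :+ con 8 :* con 1))
      refl n p k)

  -- At the lower end of the window, `above` gives `8 k² > n² - 4 (p + 1) n = 2 n² - w n - 4 n`.
  inner-below : ∀ k → suc p ℕ.≤ k →
    2 ℕ.* ((n ℕ.+ 2) ℕ.* (n ℕ.+ 2)) ℕ.≤ 8 ℕ.* (k ℕ.* k) ℕ.+ (w ℕ.+ 32) ℕ.* n
  inner-below k p<k = linear
    (above ⊕ 8 ⊛ ℕ.*-mono-≤ p<k p<k ⊕ 8 ⊛ 1≤n) (1 ℕ.+ 12 ℕ.* n)
    (solve 3 (λ n p k →
      con 2 :* ((n :+ con 2) :* (n :+ con 2))
        :+ (con 8 :* ((con 1 :+ p) :* (con 1 :+ p)) :+ con 4 :* ((con 1 :+ p) :* n)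
          :+ con 8 :* (k :* k) :+ con 8 :* n)
        :+ (con 1 :+ con 12 :* n)
      := con 8 :* (k :* k) :+ (n :+ con 4 :* p :+ con 32) :* n
        :+ (con 1 :+ n :* n :+ con 8 :* ((con 1 :+ p) :* (con 1 :+ p)) :+ con 8 :* con 1))
      refl n p k)

  -- By `below`, `8 k² ≤ 8 p² ≤ n² - 4 p n = 2 n² - w n`.
  outer-below : ∀ k → k ℕ.≤ p →
    w ℕ.* n ℕ.+ 8 ℕ.* (k ℕ.* k) ℕ.≤ 2 ℕ.* (n ℕ.* n) ℕ.+ 32 ℕ.* n
  outer-below k k≤p = linear
    (below ⊕ 8 ⊛ ℕ.*-mono-≤ k≤p k≤p) (32 ℕ.* n)
    (solve 3 (λ n p k →
      (n :+ con 4 :* p) :* n :+ con 8 :* (k :* k)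
        :+ (n :* n :+ con 8 :* (p :* p)) :+ con 32 :* n
      := con 2 :* (n :* n) :+ con 32 :* n
        :+ (con 8 :* (p :* p) :+ con 4 :* (p :* n) :+ con 8 :* (k :* k)))
      refl n p k)

  -- The expansion in `inner-above` is now a lower bound, and `above` replaces `8 p² + 4 p n` by
  -- `n²` up to O(n).
  outer-above : ∀ k → 2 ℕ.* p ℕ.+ n ℕ.≤ 2 ℕ.* k →
    w ℕ.* n ℕ.+ 2 ℕ.* ((n ℕ.+ 2) ℕ.* (n ℕ.+ 2)) ℕ.≤ 8 ℕ.* (k ℕ.* k) ℕ.+ 32 ℕ.* n
  outer-above k ≤2k = linear
    -- The error `16 p + 12 n + 15` is at most `4 n + 12 n + 16 n`; this is the source of the
    -- constant 32.
    (2 ⊛ ℕ.*-mono-≤ ≤2k ≤2k ⊕ above ⊕ 4 ⊛ 4p≤n ⊕ 16 ⊛ 1≤n) 1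
    (solve 3 (λ n p k →
      (n :+ con 4 :* p) :* n :+ con 2 :* ((n :+ con 2) :* (n :+ con 2))
        :+ (con 2 :* (con 2 :* k :* (con 2 :* k))
          :+ (con 8 :* ((con 1 :+ p) :* (con 1 :+ p)) :+ con 4 :* ((con 1 :+ p) :* n))
          :+ con 4 :* n :+ con 16 :* n)
        :+ con 1
      := con 8 :* (k :* k) :+ con 32 :* n
        :+ (con 2 :* ((con 2 :* p :+ n) :* (con 2 :* p :+ n))
          :+ (con 1 :+ n :* n) :+ con 4 :* (con 4 :* p) :+ con 16 :* con 1))
      refl n p k)

-- Bounds for the two medians

-- Medians and deviations are bounded after multiplication by 8, so that the bounds
-- are naturals.

eight : ℚ
eight = fromℕ 8

atMost? : ∀ b → Decidable (λ x → eight * x ≤ fromℕ b)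
atMost? b x = eight * x ≤? fromℕ b

-- The allowance `c` stands on the right, so that a lower bound such as `w n - 32 n` needs no
-- truncated subtraction.
atLeast? : ∀ b c → Decidable (λ x → fromℕ b ≤ eight * x + fromℕ c)
atLeast? b c x = fromℕ b ≤? eight * x + fromℕ c

median-≤ : ∀ b xs → length xs ℕ.< 2 ℕ.* count (atMost? b) xs →
  eight * median xs ≤ fromℕ b
median-≤ b = majority-downward (atMost? b)
  (λ x≤y 8y≤b → ≤-trans (*-monoˡ-≤-nonNeg eight x≤y) 8y≤b)

median-≥ : ∀ b c xs → length xs ℕ.< 2 ℕ.* count (atLeast? b c) xs →
  fromℕ b ≤ eight * median xs + fromℕ c
median-≥ b c = majority-upward (atLeast? b c)
  (λ x≤y b≤8x+c → ≤-trans b≤8x+c (+-monoˡ-≤ (fromℕ c) (*-monoˡ-≤-nonNeg eight x≤y)))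

-- `A n` is `applyUpTo square n` by definition; indices start at 0, so index `i` stands for the
-- integer `k = i + 1`.
square : ℕ → ℚ
square i = + (suc i ℕ.^ 2) / 1

eight*square : ∀ i → eight * square i ≡ fromℕ (8 ℕ.* (suc i ℕ.* suc i))
eight*square i = trans
  (cong (eight *_) (trans (/1≡fromℕ (suc i ℕ.^ 2))
    (cong (λ t → fromℕ (suc i ℕ.* t)) (ℕ.*-identityʳ (suc i)))))
  (sym (fromℕ-* 8 (suc i ℕ.* suc i)))

-- Hence any block of `⌊ n /2⌋ + 1` indices is a strict majority.
n<2*[1+⌊n/2⌋] : ∀ n → n ℕ.< 2 ℕ.* suc ⌊ n /2⌋
n<2*[1+⌊n/2⌋] n = ℕ.≤-trans (s≤s (⌊n/2⌋-lower n)) (ℕ.≤-reflexive (sym (ℕ.*-suc 2 ⌊ n /2⌋)))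

length<2*count : ∀ {P : Pred ℚ 0ℓ} (P? : Decidable P) f n {c} → n ℕ.< 2 ℕ.* c →
  c ℕ.≤ count P? (applyUpTo f n) →
  length (applyUpTo f n) ℕ.< 2 ℕ.* count P? (applyUpTo f n)
length<2*count P? f n n<2c c≤ = subst (ℕ._< 2 ℕ.* count P? (applyUpTo f n))
  (sym (length-applyUpTo f n)) (ℕ.<-≤-trans n<2c (2 ⊛ c≤))

⌊n/2⌋<n : ∀ n .{{_ : ℕ.NonZero n}} → ⌊ n /2⌋ ℕ.< n
⌊n/2⌋<n (suc n) = ℕ.⌊n/2⌋<n n

module MedianSquares (n : ℕ) .{{_ : ℕ.NonZero n}} where
  open ℕ.+-*-Solver

  h : ℕ
  h = ⌊ n /2⌋

  -- The first `h + 1` squares are a majority, and they have `2 k ≤ n + 2`.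
  8median≤ : eight * median (A n) ≤ fromℕ (2 ℕ.* ((n ℕ.+ 2) ℕ.* (n ℕ.+ 2)))
  8median≤ = median-≤ b (A n) (length<2*count (atMost? b) square n (n<2*[1+⌊n/2⌋] n)
    (count-window (atMost? b) square 0 (suc h) (⌊n/2⌋<n n) inside))
    where
    b = 2 ℕ.* ((n ℕ.+ 2) ℕ.* (n ℕ.+ 2))

    inside : ∀ i → i ℕ.< suc h → eight * square i ≤ fromℕ b
    inside i (s≤s i≤h) = subst (_≤ fromℕ b) (sym (eight*square i)) (fromℕ-mono-≤
      (linear (2 ⊛ ℕ.*-mono-≤ 2k≤ 2k≤) 0 (solve 2 (λ n k →
        con 8 :* (k :* k) :+ con 2 :* ((n :+ con 2) :* (n :+ con 2)) :+ con 0
        := con 2 :* ((n :+ con 2) :* (n :+ con 2)) :+ con 2 :* (con 2 :* k :* (con 2 :* k)))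
        refl n (suc i))))
      where
      2k≤ : 2 ℕ.* suc i ℕ.≤ n ℕ.+ 2
      2k≤ = linear (2 ⊛ i≤h ⊕ ⌊n/2⌋-upper n) 0 (solve 3 (λ n h i →
        con 2 :* (con 1 :+ i) :+ (con 2 :* h :+ n) :+ con 0
        := n :+ con 2 :+ (con 2 :* i :+ con 2 :* h)) refl n h i)

  -- The last `h + 1` squares are a majority, and they have `2 k ≥ n`.
  8median≥ : fromℕ (2 ℕ.* (n ℕ.* n)) ≤ eight * median (A n)
  8median≥ = subst (fromℕ b ≤_) (+-identityʳ (eight * median (A n)))
    (median-≥ b 0 (A n) (length<2*count (atLeast? b 0) square n (n<2*[1+⌊n/2⌋] n)
      (count-window (atLeast? b 0) square o (suc h)
        (ℕ.≤-reflexive (trans (ℕ.+-comm o (suc h)) h+o≡n)) inside)))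
    where
    b = 2 ℕ.* (n ℕ.* n)
    o = n ℕ.∸ suc h

    h+o≡n : suc h ℕ.+ o ≡ n
    h+o≡n = ℕ.m+[n∸m]≡n (⌊n/2⌋<n n)

    inside : ∀ i → i ℕ.< suc h → fromℕ b ≤ eight * square (o ℕ.+ i) + fromℕ 0
    inside i _ = subst (fromℕ b ≤_)
      (sym (trans (+-identityʳ _) (eight*square (o ℕ.+ i)))) (fromℕ-mono-≤
      (linear (2 ⊛ ℕ.*-mono-≤ ≤2k ≤2k) 0 (solve 2 (λ n k →
        con 2 :* (n :* n) :+ con 2 :* (con 2 :* k :* (con 2 :* k)) :+ con 0
        := con 8 :* (k :* k) :+ con 2 :* (n :* n)) refl n (suc (o ℕ.+ i)))))
      where
      ≤2k : n ℕ.≤ 2 ℕ.* suc (o ℕ.+ i)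
      ≤2k = linear (⌊n/2⌋-upper n ⊕ 2 ⊛ ℕ.≤-reflexive (sym h+o≡n)) (2 ℕ.* i)
        (solve 4 (λ n h o i →
          n :+ (n :+ con 2 :* (con 1 :+ h :+ o)) :+ con 2 :* i
          := con 2 :* (con 1 :+ (o :+ i)) :+ (con 2 :* h :+ con 2 :* n)) refl n h o i)

module Deviation (n-1 : ℕ) (c : Cut (suc n-1)) where
  n : ℕ
  n = suc n-1

  open Arithmetic c
  open MedianSquares n
  open ℕ.+-*-Solver

  M : ℚ
  M = median (A n)

  deviation : ℕ → ℚ
  deviation i = ∣ square i - M ∣

  a≡ : median (applyUpTo deviation n) ≡ a n
  a≡ = cong median (sym (map-applyUpTo square (λ x → ∣ x - M ∣) n))

  -- The majority is the window `p + 1, …, p + h + 1`; `4 ≤ n` makes it fit below `n`.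
  8a≤ : 4 ℕ.≤ n → eight * a n ≤ fromℕ ((w ℕ.+ 32) ℕ.* n)
  8a≤ 4≤n = subst (λ t → eight * t ≤ fromℕ b) a≡
    (median-≤ b (applyUpTo deviation n) (length<2*count (atMost? b) deviation n (n<2*[1+⌊n/2⌋] n)
      (count-window (atMost? b) deviation p (suc h) p+h<n inside)))
    where
    b = (w ℕ.+ 32) ℕ.* n

    p+h<n : p ℕ.+ suc h ℕ.≤ n
    p+h<n = ℕ.*-cancelˡ-≤ 4 (linear (4p≤n ⊕ 2 ⊛ ⌊n/2⌋-upper n ⊕ 4≤n) 0
      (solve 3 (λ n h p →
        con 4 :* (p :+ (con 1 :+ h)) :+ (n :+ con 2 :* n :+ n) :+ con 0
        := con 4 :* n :+ (con 4 :* p :+ con 2 :* (con 2 :* h) :+ con 4)) refl n h p))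

    inside : ∀ i → i ℕ.< suc h → eight * deviation (p ℕ.+ i) ≤ fromℕ b
    inside i (s≤s i≤h) = s*∣x-m∣≤b eight (square (p ℕ.+ i)) M (fromℕ b)
      (begin
        eight * square (p ℕ.+ i)            ≡⟨ eight*square (p ℕ.+ i) ⟩
        fromℕ (8 ℕ.* (k ℕ.* k))             ≤⟨ fromℕ-mono-≤ (inner-above k 2k≤) ⟩
        fromℕ (2 ℕ.* (n ℕ.* n) ℕ.+ b)       ≡⟨ fromℕ-+ (2 ℕ.* (n ℕ.* n)) b ⟩
        fromℕ (2 ℕ.* (n ℕ.* n)) + fromℕ b   ≤⟨ +-monoˡ-≤ (fromℕ b) 8median≥ ⟩
        eight * M + fromℕ b                 ∎)
      (begin
        eight * M                                   ≤⟨ 8median≤ ⟩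
        fromℕ (2 ℕ.* ((n ℕ.+ 2) ℕ.* (n ℕ.+ 2)))
          ≤⟨ fromℕ-mono-≤ (inner-below k (s≤s (ℕ.m≤m+n p i))) ⟩
        fromℕ (8 ℕ.* (k ℕ.* k) ℕ.+ b)               ≡⟨ fromℕ-+ (8 ℕ.* (k ℕ.* k)) b ⟩
        fromℕ (8 ℕ.* (k ℕ.* k)) + fromℕ b
          ≡⟨ cong (_+ fromℕ b) (eight*square (p ℕ.+ i)) ⟨
        eight * square (p ℕ.+ i) + fromℕ b          ∎)
      where
      open ≤-Reasoning
      k = suc (p ℕ.+ i)

      2k≤ : 2 ℕ.* k ℕ.≤ 2 ℕ.* p ℕ.+ n ℕ.+ 2
      2k≤ = linear (2 ⊛ i≤h ⊕ ⌊n/2⌋-upper n) 0 (solve 4 (λ n h p i →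
        con 2 :* (con 1 :+ (p :+ i)) :+ (con 2 :* h :+ n) :+ con 0
        := con 2 :* p :+ n :+ con 2 :+ (con 2 :* i :+ con 2 :* h)) refl n h p i)

  -- The majority is the complement of the window `p + 1, …, p + m`.
  8a≥ : fromℕ (w ℕ.* n) ≤ eight * a n + fromℕ (32 ℕ.* n)
  8a≥ = subst (λ t → fromℕ b ≤ eight * t + fromℕ e) a≡
    (median-≥ b e (applyUpTo deviation n) (length<2*count (atLeast? b e) deviation n n<2[p+r]
      (count-outside (atLeast? b e) deviation p m r p+m+r≡n below-p above-p+m)))
    where
    open ≤-Reasoning
    b = w ℕ.* n
    e = 32 ℕ.* n
    -- Since `2 m < n`, the complement is a strict majority; since `2 m + 2 ≥ n`, the integers after
    -- the window satisfy `2 k ≥ 2 p + n`.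
    m = ⌊ n-1 /2⌋
    r = n ℕ.∸ (p ℕ.+ m)

    p+m≤n : p ℕ.+ m ℕ.≤ n
    p+m≤n = ℕ.*-cancelˡ-≤ 4 (linear (4p≤n ⊕ 2 ⊛ ⌊n/2⌋-upper n-1) (3 ℕ.+ n-1)
      (solve 3 (λ l m p →
        con 4 :* (p :+ m) :+ (con 1 :+ l :+ con 2 :* l) :+ (con 3 :+ l)
        := con 4 :* (con 1 :+ l) :+ (con 4 :* p :+ con 2 :* (con 2 :* m)))
        refl n-1 m p))

    p+m+r≡n : p ℕ.+ m ℕ.+ r ≡ n
    p+m+r≡n = ℕ.m+[n∸m]≡n p+m≤n

    n<2[p+r] : n ℕ.< 2 ℕ.* (p ℕ.+ r)
    n<2[p+r] = linear (⌊n/2⌋-upper n-1 ⊕ 2 ⊛ ℕ.≤-reflexive (sym p+m+r≡n)) 0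
      (solve 4 (λ l m p r →
        con 2 :+ l :+ (l :+ con 2 :* (p :+ m :+ r)) :+ con 0
        := con 2 :* (p :+ r) :+ (con 2 :* m :+ con 2 :* (con 1 :+ l))) refl n-1 m p r)

    below-p : ∀ i → i ℕ.< p → fromℕ b ≤ eight * deviation i + fromℕ e
    below-p i i<p = b≤s*∣x-m∣+c eight (square i) M (fromℕ b) (fromℕ e) (inj₂ (begin
      fromℕ b + eight * square i          ≡⟨ cong (λ t → fromℕ b + t) (eight*square i) ⟩
      fromℕ b + fromℕ (8 ℕ.* (k ℕ.* k))   ≡⟨ fromℕ-+ b (8 ℕ.* (k ℕ.* k)) ⟨
      fromℕ (b ℕ.+ 8 ℕ.* (k ℕ.* k))       ≤⟨ fromℕ-mono-≤ (outer-below k i<p) ⟩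
      fromℕ (2 ℕ.* (n ℕ.* n) ℕ.+ e)       ≡⟨ fromℕ-+ (2 ℕ.* (n ℕ.* n)) e ⟩
      fromℕ (2 ℕ.* (n ℕ.* n)) + fromℕ e   ≤⟨ +-monoˡ-≤ (fromℕ e) 8median≥ ⟩
      eight * M + fromℕ e                 ∎))
      where k = suc i

    above-p+m : ∀ i → i ℕ.< r → fromℕ b ≤ eight * deviation (p ℕ.+ m ℕ.+ i) + fromℕ e
    above-p+m i _ = b≤s*∣x-m∣+c eight (square j) M (fromℕ b) (fromℕ e) (inj₁ (begin
      fromℕ b + eight * M                 ≤⟨ +-monoʳ-≤ (fromℕ b) 8median≤ ⟩
      fromℕ b + fromℕ u                   ≡⟨ fromℕ-+ b u ⟨
      fromℕ (b ℕ.+ u)                     ≤⟨ fromℕ-mono-≤ (outer-above k ≤2k) ⟩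
      fromℕ (8 ℕ.* (k ℕ.* k) ℕ.+ e)       ≡⟨ fromℕ-+ (8 ℕ.* (k ℕ.* k)) e ⟩
      fromℕ (8 ℕ.* (k ℕ.* k)) + fromℕ e   ≡⟨ cong (_+ fromℕ e) (eight*square j) ⟨
      eight * square j + fromℕ e          ∎))
      where
      j = p ℕ.+ m ℕ.+ i
      k = suc j
      u = 2 ℕ.* ((n ℕ.+ 2) ℕ.* (n ℕ.+ 2))

      ≤2k : 2 ℕ.* p ℕ.+ n ℕ.≤ 2 ℕ.* k
      ≤2k = linear (⌊n/2⌋-lower n-1) (2 ℕ.* i) (solve 4 (λ l m p i →
        con 2 :* p :+ (con 1 :+ l) :+ (con 1 :+ con 2 :* m) :+ con 2 :* i
        := con 2 :* (con 1 :+ (p :+ m :+ i)) :+ l) refl n-1 m p i)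

-- Division by `n²` and the limit

module Scaled (n : ℕ) .{{_ : ℕ.NonZero n}} where
  open ℚ.+-*-Solver

  ν : ℚ
  ν = fromℕ n

  private instance
    ν>0 : Positive ν
    ν>0 = positive (fromℕ-mono-< (ℕ.>-nonZero⁻¹ n))

  8[a/n²]n : ∀ α r → ν * ν * r ≡ 1ℚ → eight * (α * r) * ν * ν ≡ eight * α
  8[a/n²]n α r ν²r≡1 = trans
    (solve 4 (λ e α r ν → e :* (α :* r) :* ν :* ν := e :* (α :* (ν :* ν :* r)))
      refl eight α r ν)
    (cong (eight *_) (trans (cong (α *_) ν²r≡1) (*-identityʳ α)))

  ν²/n²≡1 : ν * ν * (+ 1 / (n ℕ.^ 2)) {{ℕ.m^n≢0 n 2}} ≡ 1ℚ
  ν²/n²≡1 = trans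
    (cong (_* (+ 1 / (n ℕ.^ 2)) {{ℕ.m^n≢0 n 2}}) (trans (sym (fromℕ-* n n))
      (cong (λ t → fromℕ (n ℕ.* t)) (sym (ℕ.*-identityʳ n)))))
    (fromℕ*1/n≡1 (n ℕ.^ 2) {{ℕ.m^n≢0 n 2}})

  zν≡8a : eight * a/n² n * ν * ν ≡ eight * a n
  zν≡8a = 8[a/n²]n (a n) ((+ 1 / (n ℕ.^ 2)) {{ℕ.m^n≢0 n 2}}) ν²/n²≡1

  -- As `8 a n` is `ν²` times `eight * a/n² n`, one factor `ν` cancels from the bound.
  scaled-≤ : ∀ w → eight * a n ≤ fromℕ ((w ℕ.+ 32) ℕ.* n) →
    eight * a/n² n * ν ≤ fromℕ w + fromℕ 32
  scaled-≤ w 8a≤ = *-cancelʳ-≤-pos ν (subst₂ _≤_ (sym zν≡8a)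
    (trans (fromℕ-* (w ℕ.+ 32) n) (cong (_* ν) (fromℕ-+ w 32))) 8a≤)

  scaled-≥ : ∀ w → fromℕ (w ℕ.* n) ≤ eight * a n + fromℕ (32 ℕ.* n) →
    fromℕ w ≤ eight * a/n² n * ν + fromℕ 32
  scaled-≥ w 8a≥ = *-cancelʳ-≤-pos ν (subst₂ _≤_ (fromℕ-* w n)
    (trans (cong₂ _+_ (sym zν≡8a) (fromℕ-* 32 n))
      (sym (*-distribʳ-+ ν (eight * a/n² n * ν) (fromℕ 32)))) 8a≥)

module Approximation (n w : ℕ) .{{_ : ℕ.NonZero n}}
  (w²≤3n² : w ℕ.* w ℕ.≤ 3 ℕ.* (n ℕ.* n))
  (3n²<[w+4]² : 3 ℕ.* (n ℕ.* n) ℕ.< (w ℕ.+ 4) ℕ.* (w ℕ.+ 4))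
  (x q : ℚ)
  (z≤ω+32 : eight * x * fromℕ n ≤ fromℕ w + fromℕ 32)
  (ω≤z+32 : fromℕ w ≤ eight * x * fromℕ n + fromℕ 32)
  (5≤qn : fromℕ 5 ≤ q * fromℕ n) where

  open ℚ.+-*-Solver

  ν ω y⁻ y⁺ three : ℚ
  ν = fromℕ n
  ω = fromℕ w
  -- These are the points at which the cuts of `sqrt` are tested once `⊖`, `-ℝ` and `/ℝ` are
  -- unfolded, hence `0ℚ - q` in `y⁺`.
  y⁻ = (x - q) * eight
  y⁺ = (x - (0ℚ - q)) * eight
  three = fromℕ 3

  -- This is why 5 was chosen: of the 40, 32 absorbs the error in `w` and the remaining 8 exceeds
  -- both 0, for `y⁻`, and 4, for `y⁺`.
  40≤8qν : fromℕ 32 + fromℕ 8 ≤ eight * (q * ν)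
  40≤8qν = *-monoˡ-≤-nonNeg eight 5≤qn

  y⁻ν<ω : y⁻ * ν < ω
  y⁻ν<ω = <-≤-trans
    (subst (_< y⁻ * ν + fromℕ 8) (+-identityʳ (y⁻ * ν)) (+-monoʳ-< (y⁻ * ν) (positive⁻¹ (fromℕ 8))))
    (linearℚ (+-mono-≤ z≤ω+32 40≤8qν)
      (solve 7 (λ x q e ν ω c d →
        (x :- q) :* e :* ν :+ d :+ (ω :+ c :+ e :* (q :* ν))
        := ω :+ (e :* x :* ν :+ (c :+ d))) refl x q eight ν ω (fromℕ 32) (fromℕ 8)))

  ω+8≤y⁺ν : ω + fromℕ 8 ≤ y⁺ * ν
  ω+8≤y⁺ν = linearℚ (+-mono-≤ ω≤z+32 40≤8qν)
    (solve 7 (λ x q e ν ω c d →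
      ω :+ d :+ (e :* x :* ν :+ c :+ e :* (q :* ν))
      := (x :- (con 0ℚ :- q)) :* e :* ν :+ (ω :+ (c :+ d)))
      refl x q eight ν ω (fromℕ 32) (fromℕ 8))

  ω+4<y⁺ν : fromℕ (w ℕ.+ 4) < y⁺ * ν
  ω+4<y⁺ν = <-≤-trans (fromℕ-mono-< (ℕ.+-monoʳ-< w (ℕ.m≤m+n 5 3)))
    (subst (_≤ y⁺ * ν) (sym (fromℕ-+ w 8)) ω+8≤y⁺ν)

  3n²≡3ν² : fromℕ (3 ℕ.* (n ℕ.* n)) ≡ three * (ν * ν)
  3n²≡3ν² = trans (fromℕ-* 3 (n ℕ.* n)) (cong (three *_) (fromℕ-* n n))

  [yν]²≡y²ν² : ∀ y → y * ν * (y * ν) ≡ y * y * (ν * ν)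
  [yν]²≡y²ν² y = solve 2 (λ y ν → y :* ν :* (y :* ν) := y :* y :* (ν :* ν)) refl y ν

  ν²≥0 : NonNegative (ν * ν)
  ν²≥0 = nonNeg*nonNeg⇒nonNeg ν ν

  -- Squaring `y⁻ ν < w` and using `w² ≤ 3 n²` requires `y⁻ ≥ 0`; a negative `y⁻` is the other
  -- alternative of the lower cut.
  y⁻<√3 : y⁻ < 0ℚ ⊎ y⁻ * y⁻ < three
  y⁻<√3 with y⁻ <? 0ℚ
  ... | yes y⁻<0 = inj₁ y⁻<0
  ... | no  y⁻≮0 = inj₂ (*-cancelʳ-<-nonNeg (ν * ν) {{ν²≥0}} (begin-strict
    y⁻ * y⁻ * (ν * ν)         ≡⟨ [yν]²≡y²ν² y⁻ ⟨
    y⁻ * ν * (y⁻ * ν)         <⟨ sq-mono-< 0≤y⁻ν y⁻ν<ω ⟩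
    ω * ω                     ≡⟨ fromℕ-* w w ⟨
    fromℕ (w ℕ.* w)           ≤⟨ fromℕ-mono-≤ w²≤3n² ⟩
    fromℕ (3 ℕ.* (n ℕ.* n))   ≡⟨ 3n²≡3ν² ⟩
    three * (ν * ν)           ∎))
    where
    open ≤-Reasoning
    0≤y⁻ν : 0ℚ ≤ y⁻ * ν
    0≤y⁻ν = subst (_≤ y⁻ * ν) (*-zeroˡ ν) (*-monoʳ-≤-nonNeg ν (≮⇒≥ y⁻≮0))

  √3<y⁺ : 0ℚ < y⁺ × three < y⁺ * y⁺
  √3<y⁺ =
    *-cancelʳ-<-nonNeg ν (subst (_< y⁺ * ν) (sym (*-zeroˡ ν)) (≤-<-trans 0≤w+4 ω+4<y⁺ν)) ,
    *-cancelʳ-<-nonNeg (ν * ν) {{ν²≥0}} (begin-strict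
      three * (ν * ν)                       ≡⟨ 3n²≡3ν² ⟨
      fromℕ (3 ℕ.* (n ℕ.* n))               <⟨ fromℕ-mono-< 3n²<[w+4]² ⟩
      fromℕ ((w ℕ.+ 4) ℕ.* (w ℕ.+ 4))       ≡⟨ fromℕ-* (w ℕ.+ 4) (w ℕ.+ 4) ⟩
      fromℕ (w ℕ.+ 4) * fromℕ (w ℕ.+ 4)     <⟨ sq-mono-< 0≤w+4 ω+4<y⁺ν ⟩
      y⁺ * ν * (y⁺ * ν)                     ≡⟨ [yν]²≡y²ν² y⁺ ⟩
      y⁺ * y⁺ * (ν * ν)                     ∎)
    where
    open ≤-Reasoning
    0≤w+4 : 0ℚ ≤ fromℕ (w ℕ.+ 4)
    0≤w+4 = fromℕ-mono-≤ z≤n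

theorem3 : a/n² ⟶ (sqrt (+ 3 / 1) /ℝ (+ 8 / 1))
-- Positivity of `ε` supplies a rational `q` with `0 < q < ε`. The threshold ensures `5 ≤ q n` and,
-- being at least 5, also the `4 ≤ n` of `8a≤`.
theorem3 ε (q , 0<q , q<ε) = 5 ℕ.* suc d , close
  where
  ℓ : ℝ
  ℓ = sqrt (+ 3 / 1) /ℝ (+ 8 / 1)

  d : ℕ
  d = proj₁ (archimedean 0<q 5)

  4≤5d : 4 ℕ.≤ 5 ℕ.* suc d
  4≤5d = ℕ.≤-trans (ℕ.m≤m+n 4 1) (ℕ.m≤m*n 5 (suc d))

  close : ∀ n .{{_ : ℕ.NonZero n}} → 5 ℕ.* suc d ℕ.≤ n → ∣ a/n² n ⊖ ℓ ∣ℝ <ℝ ε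
  -- `q` separates the distance from `ε`: the inner pair bounds the difference and its negative by
  -- `q`.
  close n@(suc n-1) 5d≤n = q , (y⁻<√3 , √3<y⁺) , q<ε
    where
    open Arithmetic (cut-exists n)
    open Deviation n-1 (cut-exists n) using (8a≤; 8a≥)
    open Scaled n
    open Approximation n w w²≤3n² 3n²<[w+4]² (a/n² n) q
      (scaled-≤ w (8a≤ (ℕ.≤-trans 4≤5d 5d≤n))) (scaled-≥ w 8a≥)
      (proj₂ (archimedean 0<q 5) n 5d≤n)
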